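{- Let $t, r$ be integers with $1 \leq t \leq r$, let $k$ be a positive integer, and let $\mathcal{H}$ be a hereditary family with $\mu(\mathcal{H}) \geq n_{\rm S}(r,t)$. Let $\mathcal{A}_1, \dots, \mathcal{A}_k$ be cross-$t$-intersecting subfamilies of $\mathcal{H}^{(\leq r)}$, and let $\mathcal{L}$ be a largest $t$-star of $\mathcal{H}^{(\leq r)}$. Then \[\sum_{i = 1}^k |\mathcal{A}_i| \leq \max\left\{ k|\mathcal{L}|, |\mathcal{H}^{(\leq r)}| \right\}.\]
   Context: All sets and families are finite. For a positive integer $k$, $[k] := \{1,\dots,k\}$. A family $\mathcal{H}$ is hereditary if every subset of every member of $\mathcal{H}$ is a member of $\mathcal{H}$. A base of a family $\mathcal{F}$ is a set $B \in \mathcal{F}$ that is not a proper subset of any member of $\mathcal{F}$; $\mu(\mathcal{F})$ denotes the size of a smallest base of $\mathcal{F}$. $\mathcal{H}^{(\leq r)} := \{H \in \mathcal{H} : |H| \leq r\}$. For a family $\mathcal{F}$ and a set $T$, $\mathcal{F}\langle T\rangle := \{F \in \mathcal{F} : T \subseteq F\}$; this is a $t$-star of $\mathcal{F}$ if $|T| = t$, and a largest $t$-star is one of maximum size among all $t$-stars of $\mathcal{F}$. A set $A$ $t$-intersects $B$ if $|A\cap B| \ge t$. Families $\mathcal{A}_1,\dots,\mathcal{A}_k$ are cross-$t$-intersecting if for all distinct $i,j \in [k]$, every set in $\mathcal{A}_i$ $t$-intersects every set in $\mathcal{A}_j$. Define $m(r,t) := \max\{2r, \frac{(r-t)(r-t+5)}{2}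 + (t-1)\}$ and $n_{\rm S}(r,t) := (r-t+1)\binom{m(r,t)}{t+1} + r$. -}

module Defs where

open import Data.Bool using (Bool; true; false; _∧_)
open import Data.Nat using (ℕ; zero; suc; _+_; _*_; _∸_; _≤_; _⊔_; _≤ᵇ_)
open import Data.Nat.DivMod using (_/_)
open import Data.Nat.Combinatorics using (_C_)
open import Data.Fin using (Fin)
open import Data.Fin.Subset using (Subset; _⊆_; _∩_; ∣_∣)
open import Data.Fin.Subset.Properties using (_⊆?_)
open import Data.List using (List; []; _∷_; _++_; map; filter; length; allFin)
open import Data.Nat.ListAction using (sum)
open import Data.Vec using (Vec; []; _∷_)
open import Data.Product using (_×_)
open import Relation.Binary.PropositionalEquality using (_≡_; _≢_)
open import Relation.Nullary.Decidable using (⌊_⌋)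

-- Ground set: Fin n. A set is a Subset n; a family of sets is a
-- Boolean membership predicate on Subset n (families are finite).
Family : ℕ → Set
Family n = Subset n → Bool

_∈F_ : ∀ {n} → Subset n → Family n → Set
S ∈F F = F S ≡ true

allSubsets : (n : ℕ) → List (Subset n)
allSubsets zero = [] ∷ []
allSubsets (suc n) = map (true ∷_) (allSubsets n) ++ map (false ∷_) (allSubsets n)

size : ∀ {n} → Family n → ℕ
size {n} F = length (filter (λ S → F S Data.Bool.≟ true) (allSubsets n))
  where import Data.Bool

Hereditary : ∀ {n} → Family n → Set
Hereditary {n} H = (A B : Subset n) → B ⊆ A → A ∈F H → B ∈F H

IsBase : ∀ {n} → Family n → Subset n → Set
IsBase {n} F B = B ∈F F × ((C : Subset n) → C ∈F F → B ⊆ C → B ≡ C)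

-- μ(F) ≥ N : every base (hence a smallest base) has size at least N
μ≥ : ∀ {n} → Family n → ℕ → Set
μ≥ {n} F N = (B : Subset n) → IsBase F B → N ≤ ∣ B ∣

upTo : ∀ {n} → Family n → ℕ → Family n
upTo H r S = H S ∧ (∣ S ∣ ≤ᵇ r)

star : ∀ {n} → Family n → Subset n → Family n
star F T S = F S ∧ ⌊ T ⊆? S ⌋

IsLargestStar : ∀ {n} → Family n → ℕ → Subset n → Set
IsLargestStar {n} F t T =
  ∣ T ∣ ≡ t × ((T' : Subset n) → ∣ T' ∣ ≡ t → size (star F T') ≤ size (star F T))

SubFamily : ∀ {n} → Family n → Family n → Set
SubFamily {n} A H = (S : Subset n) → S ∈F A → S ∈F H

CrossIntersecting : ∀ {n k} → ℕ → (Fin k → Family n) → Set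
CrossIntersecting {n} {k} t A =
  (i j : Fin k) → i ≢ j → (S S' : Subset n) → S ∈F A i → S' ∈F A j → t ≤ ∣ S ∩ S' ∣

-- m(r,t) = max{2r, (r-t)(r-t+5)/2 + (t-1)}  (the product is always even)
m : ℕ → ℕ → ℕ
m r t = (2 * r) ⊔ (((r ∸ t) * (r ∸ t + 5)) / 2 + (t ∸ 1))

nS : ℕ → ℕ → ℕ
nS r t = (r ∸ t + 1) * (m r t C (t + 1)) + r

sumSizes : ∀ {n k} → (Fin k → Family n) → ℕ
sumSizes {n} {k} A = sum (map (λ i → size (A i)) (allFin k))

-- Let F = H^(≤ r) and let U be the union of the Aᵢ. Call core the members of U that t-intersect all
-- members of U, and rest the others. A set lying in two of the Aᵢ is in the core, so
-- Σ |Aᵢ| ≤ k |core| + |rest|, and it suffices that |F| |core| + |L| |rest| ≤ |L| |F|. This is clear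
-- if the core is empty, or if all members of U contain a fixed t-set (then the rest is empty). Otherwise there are
-- A₁, A₂ in the core with |A₁ ∩ A₂| = t and B in U with A₁ ∩ A₂ ⊈ B, and every core set meets
-- X = A₁ ∪ A₂ ∪ B in more than t points (if no such A₁, A₂ exist, X is any core set). So the core is
-- covered by C(m, t+1) stars of (t+1)-sets, and the rest by C(r, t) stars of t-sets, because
-- its members t-intersect a fixed core set. As all bases are large, exchanging one element shows that passing from
-- S to S ∪ {x} shrinks a star by the factor (r - |S|) / (nS - r), which makes the core at most
-- (r-t)/(r-t+1) |L| and the rest at most |F|/(r-t+1).
module Submission where

open import Defs
open import Data.Nat using (ℕ; _≤_; _*_; _⊔_)
open import Data.Fin using (Fin)
open import Data.Fin.Subset using (Subset)

open import Data.Bool using (true; false; if_then_else_)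
import Data.Bool as Bool
open import Data.Bool.Properties using (T-≡)
open import Data.Empty using (⊥-elim)
open import Data.Fin using (zero; suc)
import Data.Fin.Properties as Fin
open import Data.Fin.Subset
  using (_∈_; _∉_; _⊆_; _⊂_; _∩_; _∪_; ∣_∣; inside; outside) renaming (⊥ to ∅)
open import Data.Fin.Subset.Induction using (⊃-wellFounded; Acc; acc)
open import Data.Fin.Subset.Properties
open import Data.List using (List; []; _∷_; _++_; map; filter; length; allFin)
open import Data.List.Properties using (map-∘; map-tabulate; map-++)
open import Data.Nat using (zero; suc; _+_; _∸_; _<_; _≤?_; _<?_; z≤n; s≤s; >-nonZero)
open import Data.Nat.Combinatorics using (_C_; nCk+nC[k+1]≡[n+1]C[k+1]; nCn≡1; nCk≡nC[n∸k])
open import Data.Nat.DivMod using (m*n/n≡m; /-monoˡ-≤)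
open import Data.Nat.ListAction using (sum)
open import Data.Nat.ListAction.Properties using (sum-++)
open import Data.Nat.Properties
open import Data.Nat.Tactic.RingSolver using (solve-∀)
open import Data.Product using (∃; ∃₂; _×_; _,_; proj₁; proj₂)
open import Data.Sum using (_⊎_; inj₁; inj₂)
open import Data.Vec using ([]; _∷_; here; there; _[_]≔_)
open import Data.Vec.Properties using ([]≔-updates; []≔-minimal)
open import Function using (_∘_; id; Equivalence)
open import Relation.Binary.PropositionalEquality
  using (_≡_; _≢_; refl; sym; trans; cong; cong₂; subst; module ≡-Reasoning)
open import Relation.Nullary using (¬_; Dec; yes; no; does; ¬?; contradiction; _×-dec_)
open import Relation.Nullary.Decidable using (decidable-stable; isYes≗does; dec-true; map′)
open import Relation.Unary using (Decidable)

private
  variable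
    n : ℕ
    I J : Set

-- Sums and indicators

∑ : List I → (I → ℕ) → ℕ
∑ xs f = sum (map f xs)

-- Only the boolean `does P?` is inspected, so indicators of `_∈?_` and `_⊆?_` on a nonempty vector
-- reduce definitionally to those on its tail. The inductions over the ground set rely on this.
𝟙 : {P : Set} → Dec P → ℕ
𝟙 P? = if does P? then 1 else 0

𝟙-true : {P : Set} (P? : Dec P) → P → 𝟙 P? ≡ 1
𝟙-true P? p rewrite dec-true P? p = refl

𝟙*-≤ : {P : Set} (P? : Dec P) {u v : ℕ} → (P → u ≤ v) → 𝟙 P? * u ≤ v
𝟙*-≤ (yes p) {u} h = ≤-trans (≤-reflexive (*-identityˡ u)) (h p)
𝟙*-≤ (no _)      h = z≤n

𝟙-≤ : {P : Set} (P? : Dec P) {v : ℕ} → (P → 1 ≤ v) → 𝟙 P? ≤ v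
𝟙-≤ (yes p) h = h p
𝟙-≤ (no _)  h = z≤n

*𝟙-≤ : {P : Set} (P? : Dec P) (u : ℕ) {v : ℕ} → (P → u ≤ v) → u * 𝟙 P? ≤ v
*𝟙-≤ P? u h = ≤-trans (≤-reflexive (*-comm u (𝟙 P?))) (𝟙*-≤ P? h)

1≤𝟙 : {P : Set} (P? : Dec P) → P → 1 ≤ 𝟙 P?
1≤𝟙 P? p = ≤-reflexive (sym (𝟙-true P? p))

≤𝟙* : {P : Set} (P? : Dec P) {u v : ℕ} → P → u ≤ v → u ≤ 𝟙 P? * v
≤𝟙* P? {u} {v} p u≤v rewrite 𝟙-true P? p = ≤-trans u≤v (≤-reflexive (sym (*-identityˡ v)))

∑-mono : (xs : List I) {f g : I → ℕ} → (∀ x → f x ≤ g x) → ∑ xs f ≤ ∑ xs g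
∑-mono []       h = z≤n
∑-mono (x ∷ xs) h = +-mono-≤ (h x) (∑-mono xs h)

∑-cong : (xs : List I) {f g : I → ℕ} → (∀ x → f x ≡ g x) → ∑ xs f ≡ ∑ xs g
∑-cong []       h = refl
∑-cong (x ∷ xs) h = cong₂ _+_ (h x) (∑-cong xs h)

∑-+ : (xs : List I) (f g : I → ℕ) → ∑ xs (λ x → f x + g x) ≡ ∑ xs f + ∑ xs g
∑-+ []       f g = refl
∑-+ (x ∷ xs) f g rewrite ∑-+ xs f g = interchange (f x) (g x) (∑ xs f) (∑ xs g)
  where
  interchange : ∀ a b c d → (a + b) + (c + d) ≡ (a + c) + (b + d)
  interchange = solve-∀

∑-*ˡ : (xs : List I) (c : ℕ) (f : I → ℕ) → ∑ xs (λ x → c * f x) ≡ c * ∑ xs f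
∑-*ˡ []       c f = sym (*-zeroʳ c)
∑-*ˡ (x ∷ xs) c f rewrite ∑-*ˡ xs c f = sym (*-distribˡ-+ c (f x) (∑ xs f))

∑-zero : (xs : List I) → ∑ xs (λ _ → 0) ≡ 0
∑-zero []       = refl
∑-zero (x ∷ xs) = ∑-zero xs

∑-swap : (xs : List I) (ys : List J) (f : I → J → ℕ) →
  ∑ xs (λ x → ∑ ys (f x)) ≡ ∑ ys (λ y → ∑ xs (λ x → f x y))
∑-swap []       ys f = sym (∑-zero ys)
∑-swap (x ∷ xs) ys f rewrite ∑-swap xs ys f =
  sym (∑-+ ys (f x) (λ y → ∑ xs (λ x → f x y)))

∑-allFin : (k : ℕ) (f : Fin (suc k) → ℕ) → ∑ (allFin (suc k)) f ≡ f zero + ∑ (allFin k) (f ∘ suc)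
∑-allFin k f = cong (λ xs → f zero + sum xs)
  (trans (map-tabulate suc f) (sym (map-tabulate id (f ∘ suc))))

∑-allFin-≤ : (k : ℕ) {f : Fin k → ℕ} → (∀ i → f i ≤ 1) → ∑ (allFin k) f ≤ k
∑-allFin-≤ zero    h = z≤n
∑-allFin-≤ (suc k) {f} h rewrite ∑-allFin k f = +-mono-≤ (h zero) (∑-allFin-≤ k (h ∘ suc))

∑-atMostOne : (k : ℕ) {P : Fin k → Set} (P? : Decidable P) →
  (∀ i j → P i → P j → i ≡ j) → ∑ (allFin k) (λ i → 𝟙 (P? i)) ≤ 1
∑-atMostOne zero    P? h = z≤n
∑-atMostOne (suc k) P? h rewrite ∑-allFin k (λ i → 𝟙 (P? i)) with P? zero
... | no _  = ∑-atMostOne k (P? ∘ suc) (λ i j p q → Fin.suc-injective (h (suc i) (suc j) p q))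
... | yes p = s≤s (≤-trans
  (∑-mono (allFin k) (λ i → 𝟙-≤ (P? (suc i)) {0} (λ q → ⊥-elim (Fin.0≢1+n (h zero (suc i) p q)))))
  (≤-reflexive (∑-zero (allFin k))))

∑-card : (S : Subset n) → ∑ (allFin n) (λ y → 𝟙 (y ∈? S)) ≡ ∣ S ∣
∑-card {n = zero}  []        = refl
∑-card {n = suc n} (inside  ∷ S) rewrite ∑-allFin n (λ y → 𝟙 (y ∈? (inside ∷ S)))  = cong suc (∑-card S)
∑-card {n = suc n} (outside ∷ S) rewrite ∑-allFin n (λ y → 𝟙 (y ∈? (outside ∷ S))) = ∑-card S

-- Sums over all subsets, and sizes of families

∑ˢ : (Subset n → ℕ) → ℕ
∑ˢ {n} f = ∑ (allSubsets n) f

∑ˢ-suc : (f : Subset (suc n) → ℕ) → ∑ˢ f ≡ ∑ˢ (f ∘ (true ∷_)) + ∑ˢ (f ∘ (false ∷_))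
∑ˢ-suc {n} f = begin
  sum (map f (map (true ∷_) Ss ++ map (false ∷_) Ss))                ≡⟨ cong sum (map-++ f (map (true ∷_) Ss) _) ⟩
  sum (map f (map (true ∷_) Ss) ++ map f (map (false ∷_) Ss))        ≡⟨ sum-++ (map f (map (true ∷_) Ss)) _ ⟩
  sum (map f (map (true ∷_) Ss)) + sum (map f (map (false ∷_) Ss))   ≡⟨ cong₂ _+_ (cong sum (sym (map-∘ Ss))) (cong sum (sym (map-∘ Ss))) ⟩
  ∑ˢ (f ∘ (true ∷_)) + ∑ˢ (f ∘ (false ∷_))                           ∎
  where
  open ≡-Reasoning
  Ss = allSubsets n

_∈F?_ : (S : Subset n) (F : Family n) → Dec (S ∈F F)
S ∈F? F = F S Bool.≟ true

length-filter : {P : I → Set} (P? : Decidable P) (xs : List I) →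
  length (filter P? xs) ≡ ∑ xs (λ x → 𝟙 (P? x))
length-filter P? []       = refl
length-filter P? (x ∷ xs) with does (P? x)
... | true  = cong suc (length-filter P? xs)
... | false = length-filter P? xs

size≡∑ : (F : Family n) → size F ≡ ∑ˢ (λ S → 𝟙 (S ∈F? F))
size≡∑ {n} F = length-filter (_∈F? F) (allSubsets n)

size-mono : {F G : Family n} → SubFamily F G → size F ≤ size G
size-mono {n} {F} {G} F⊆G rewrite size≡∑ F | size≡∑ G =
  ∑-mono (allSubsets n) (λ S → 𝟙-≤ (S ∈F? F) (λ S∈F → 1≤𝟙 (S ∈F? G) (F⊆G S S∈F)))

size-empty : (F : Family n) → (∀ S → ¬ S ∈F F) → size F ≡ 0
size-empty {n} F F-empty rewrite size≡∑ F = n≤0⇒n≡0 (≤-trans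
  (∑-mono (allSubsets n) (λ S → 𝟙-≤ (S ∈F? F) {0} (⊥-elim ∘ F-empty S)))
  (≤-reflexive (∑-zero (allSubsets n))))

module _ {F : Family n} {T S : Subset n} where

  ∈star⁺ : S ∈F F → T ⊆ S → S ∈F star F T
  ∈star⁺ S∈F T⊆S rewrite S∈F = trans (isYes≗does (T ⊆? S)) (dec-true (T ⊆? S) T⊆S)

  ∈star⁻ : S ∈F star F T → S ∈F F × T ⊆ S
  ∈star⁻ p with F S | T ⊆? S
  ... | true | yes T⊆S = refl , T⊆S

module _ {H : Family n} {r : ℕ} {S : Subset n} where

  ∈upTo⁺ : S ∈F H → ∣ S ∣ ≤ r → S ∈F upTo H r
  ∈upTo⁺ S∈H ∣S∣≤r rewrite S∈H = Equivalence.to T-≡ (≤⇒≤ᵇ ∣S∣≤r)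

  ∈upTo⁻ : S ∈F upTo H r → S ∈F H × ∣ S ∣ ≤ r
  ∈upTo⁻ p with H S
  ... | true = refl , ≤ᵇ⇒≤ ∣ S ∣ r (Equivalence.from T-≡ p)

-- Subsets

-- A coordinate update, rather than a union with a singleton, so that insertion computes along the
-- vector.
_∪｛_｝ : Subset n → Fin n → Subset n
S ∪｛ y ｝ = S [ y ]≔ inside

⊆-insert : (S : Subset n) (y : Fin n) → S ⊆ S ∪｛ y ｝
⊆-insert S y {x} x∈S with x Fin.≟ y
... | yes refl = []≔-updates S y
... | no x≢y   = []≔-minimal S x y x≢y x∈S

insert⁻ : (S : Subset n) (y : Fin n) {x : Fin n} → x ∈ S ∪｛ y ｝ → x ≡ y ⊎ x ∈ S
insert⁻ (_ ∷ S) zero    here      = inj₁ refl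
insert⁻ (_ ∷ S) zero    (there p) = inj₂ (there p)
insert⁻ (_ ∷ S) (suc y) here      = inj₂ here
insert⁻ (_ ∷ S) (suc y) (there p) with insert⁻ S y p
... | inj₁ refl = inj₁ refl
... | inj₂ q    = inj₂ (there q)

insert-⊆ : {S B : Subset n} {y : Fin n} → S ⊆ B → y ∈ B → S ∪｛ y ｝ ⊆ B
insert-⊆ {S = S} {y = y} S⊆B y∈B p with insert⁻ S y p
... | inj₁ refl = y∈B
... | inj₂ q    = S⊆B q

∣insert∣ : (S : Subset n) (y : Fin n) → y ∉ S → ∣ S ∪｛ y ｝ ∣ ≡ suc ∣ S ∣
∣insert∣ (inside  ∷ S) zero    y∉S = contradiction here y∉S
∣insert∣ (outside ∷ S) zero    y∉S = refl
∣insert∣ (inside  ∷ S) (suc y) y∉S = cong suc (∣insert∣ S y (y∉S ∘ there))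
∣insert∣ (outside ∷ S) (suc y) y∉S = ∣insert∣ S y (y∉S ∘ there)

-- Stars are compared along insertions, so a nonempty set is presented as the insertion of its first
-- element.
insert-view : {s : ℕ} (S : Subset n) → ∣ S ∣ ≡ suc s →
  ∃₂ λ S₀ x → x ∉ S₀ × ∣ S₀ ∣ ≡ s × S ≡ S₀ ∪｛ x ｝
insert-view (inside ∷ S)  eq = outside ∷ S , zero , (λ ()) , suc-injective eq , refl
insert-view (outside ∷ S) eq with insert-view S eq
... | S₀ , x , x∉S₀ , ∣S₀∣ , refl = outside ∷ S₀ , suc x , (λ { (there p) → x∉S₀ p }) , ∣S₀∣ , refl

∣∪∣+∣∩∣ : (P Q : Subset n) → ∣ P ∪ Q ∣ + ∣ P ∩ Q ∣ ≡ ∣ P ∣ + ∣ Q ∣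
∣∪∣+∣∩∣ []            []            = refl
∣∪∣+∣∩∣ (inside  ∷ P) (inside  ∷ Q) = cong suc (trans (+-suc _ _) (trans (cong suc (∣∪∣+∣∩∣ P Q)) (sym (+-suc _ _))))
∣∪∣+∣∩∣ (inside  ∷ P) (outside ∷ Q) = cong suc (∣∪∣+∣∩∣ P Q)
∣∪∣+∣∩∣ (outside ∷ P) (inside  ∷ Q) = trans (cong suc (∣∪∣+∣∩∣ P Q)) (sym (+-suc _ _))
∣∪∣+∣∩∣ (outside ∷ P) (outside ∷ Q) = ∣∪∣+∣∩∣ P Q

⊆∧∣≥∣⇒⊇ : {P Q : Subset n} → P ⊆ Q → ∣ Q ∣ ≤ ∣ P ∣ → Q ⊆ P
⊆∧∣≥∣⇒⊇ {P = P} P⊆Q ∣Q∣≤∣P∣ {x} x∈Q = decidable-stable (x ∈? P)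
  (λ x∉P → <⇒≱ (p⊂q⇒∣p∣<∣q∣ (P⊆Q , x , x∈Q , x∉P)) ∣Q∣≤∣P∣)

∩-⊆ : {P Q R : Subset n} → P ⊆ Q → P ⊆ R → P ⊆ Q ∩ R
∩-⊆ P⊆Q P⊆R x∈P = x∈p∩q⁺ (P⊆Q x∈P , P⊆R x∈P)

-- Binomial coefficients

nC0≡1 : ∀ n → n C 0 ≡ 1
nC0≡1 n = trans (nCk≡nC[n∸k] {0} {n} z≤n) (nCn≡1 n)

C-step : ∀ n k → n C k ≤ suc n C k
C-step n zero    = ≤-reflexive (trans (nC0≡1 n) (sym (nC0≡1 (suc n))))
C-step n (suc k) = ≤-trans (m≤n+m _ (n C k)) (≤-reflexive (nCk+nC[k+1]≡[n+1]C[k+1] n k))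

C-mono : ∀ {i j} k → i ≤ j → i C k ≤ j C k
C-mono {i} k i≤j with m≤n⇒∃[o]m+o≡n i≤j
... | o , refl = go o
  where
  go : ∀ o → i C k ≤ (i + o) C k
  go zero    = ≤-reflexive (cong (_C k) (sym (+-identityʳ i)))
  go (suc o) = ≤-trans (go o) (≤-trans (C-step (i + o) k) (≤-reflexive (cong (_C k) (sym (+-suc i o)))))

-- Pascal's rule applied `a` times: each step from `n` up to `a + n` adds at least C(n, k).
*C≤C : ∀ a n k → a * (n C k) ≤ (a + n) C suc k
*C≤C zero    n k = z≤n
*C≤C (suc a) n k = begin
  n C k + a * (n C k)              ≤⟨ +-mono-≤ (C-mono k (m≤n+m n a)) (*C≤C a n k) ⟩
  (a + n) C k + (a + n) C suc k    ≡⟨ nCk+nC[k+1]≡[n+1]C[k+1] (a + n) k ⟩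
  suc (a + n) C suc k              ∎
  where open ≤-Reasoning

-- Covering by stars

-- A union bound over the `s`-subsets of `X`: a set meeting `X` in at least `s` points contains one
-- of them. Induction along the coordinates with Pascal's rule avoids listing these subsets; the
-- weight `g` is arbitrary so that it can absorb the coordinate that is dropped.
cover : (g : Subset n → ℕ) (X : Subset n) (s M : ℕ) →
  (∀ T → ∣ T ∣ ≡ s → ∑ˢ (λ S → 𝟙 (T ⊆? S) * g S) ≤ M) →
  ∑ˢ (λ S → 𝟙 (s ≤? ∣ S ∩ X ∣) * g S) ≤ (∣ X ∣ C s) * M
cover {n} g X zero M h = begin
  ∑ˢ (λ S → 𝟙 (0 ≤? ∣ S ∩ X ∣) * g S)    ≤⟨ ∑-mono (allSubsets n) (λ S → 𝟙*-≤ (0 ≤? ∣ S ∩ X ∣) (λ _ → ≤𝟙* (∅ ⊆? S) (⊆-min S) ≤-refl)) ⟩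
  ∑ˢ (λ S → 𝟙 (∅ ⊆? S) * g S)            ≤⟨ h ∅ (∣⊥∣≡0 n) ⟩
  M                                      ≡⟨ sym (*-identityˡ M) ⟩
  1 * M                                  ≡⟨ cong (_* M) (sym (nC0≡1 ∣ X ∣)) ⟩
  (∣ X ∣ C 0) * M                        ∎
  where open ≤-Reasoning
cover g [] (suc s) M h = z≤n
cover {suc n} g (outside ∷ X) (suc s) M h = begin
  ∑ˢ (λ S → 𝟙 (suc s ≤? ∣ S ∩ (outside ∷ X) ∣) * g S)     ≡⟨ ∑ˢ-suc (λ S → 𝟙 (suc s ≤? ∣ S ∩ (outside ∷ X) ∣) * g S) ⟩
  ∑ˢ (λ S → w S * g (true ∷ S)) + ∑ˢ (λ S → w S * g (false ∷ S)) ≡⟨ sym (∑-+ (allSubsets n) _ _) ⟩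
  ∑ˢ (λ S → w S * g (true ∷ S) + w S * g (false ∷ S))     ≡⟨ ∑-cong (allSubsets n) (λ S → sym (*-distribˡ-+ (w S) _ _)) ⟩
  ∑ˢ (λ S → w S * g₊ S)                                   ≤⟨ cover g₊ X (suc s) M h′ ⟩
  (∣ X ∣ C suc s) * M                                     ∎
  where
  open ≤-Reasoning
  w : Subset n → ℕ
  w S = 𝟙 (suc s ≤? ∣ S ∩ X ∣)
  -- The first element lies outside `X` and has no influence on the condition, so the weights of its
  -- two options are merged.
  g₊ : Subset n → ℕ
  g₊ S = g (true ∷ S) + g (false ∷ S)
  h′ : ∀ T → ∣ T ∣ ≡ suc s → ∑ˢ (λ S → 𝟙 (T ⊆? S) * g₊ S) ≤ M
  h′ T ∣T∣ = begin
    ∑ˢ (λ S → 𝟙 (T ⊆? S) * g₊ S)                                      ≡⟨ ∑-cong (allSubsets n) (λ S → *-distribˡ-+ (𝟙 (T ⊆? S)) _ _) ⟩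
    ∑ˢ (λ S → 𝟙 (T ⊆? S) * g (true ∷ S) + 𝟙 (T ⊆? S) * g (false ∷ S)) ≡⟨ ∑-+ (allSubsets n) _ _ ⟩
    ∑ˢ (λ S → 𝟙 (T ⊆? S) * g (true ∷ S)) + ∑ˢ (λ S → 𝟙 (T ⊆? S) * g (false ∷ S)) ≡⟨ sym (∑ˢ-suc (λ S → 𝟙 ((outside ∷ T) ⊆? S) * g S)) ⟩
    ∑ˢ (λ S → 𝟙 ((outside ∷ T) ⊆? S) * g S)                           ≤⟨ h (outside ∷ T) ∣T∣ ⟩
    M                                                                 ∎
cover {suc n} g (inside ∷ X) (suc s) M h = begin
  ∑ˢ (λ S → 𝟙 (suc s ≤? ∣ S ∩ (inside ∷ X) ∣) * g S)     ≡⟨ ∑ˢ-suc (λ S → 𝟙 (suc s ≤? ∣ S ∩ (inside ∷ X) ∣) * g S) ⟩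
  ∑ˢ (λ S → 𝟙 (suc s ≤? suc ∣ S ∩ X ∣) * g (true ∷ S)) + ∑ˢ (λ S → 𝟙 (suc s ≤? ∣ S ∩ X ∣) * g (false ∷ S))
    -- A set containing the first element of `X` needs only `s` further points of `X`, which
    -- produces the first term of Pascal's rule.
    ≤⟨ +-monoˡ-≤ _ (∑-mono (allSubsets n) (λ S → 𝟙*-≤ (suc s ≤? suc ∣ S ∩ X ∣) (λ { (s≤s p) → ≤𝟙* (s ≤? ∣ S ∩ X ∣) p ≤-refl }))) ⟩
  ∑ˢ (λ S → 𝟙 (s ≤? ∣ S ∩ X ∣) * g (true ∷ S)) + ∑ˢ (λ S → 𝟙 (suc s ≤? ∣ S ∩ X ∣) * g (false ∷ S))
    ≤⟨ +-mono-≤ (cover (g ∘ (true ∷_)) X s M h₁) (cover (g ∘ (false ∷_)) X (suc s) M h₀) ⟩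
  (∣ X ∣ C s) * M + (∣ X ∣ C suc s) * M                  ≡⟨ sym (*-distribʳ-+ M (∣ X ∣ C s) _) ⟩
  (∣ X ∣ C s + ∣ X ∣ C suc s) * M                        ≡⟨ cong (_* M) (nCk+nC[k+1]≡[n+1]C[k+1] ∣ X ∣ s) ⟩
  (suc ∣ X ∣ C suc s) * M                                ∎
  where
  open ≤-Reasoning
  h₁ : ∀ T → ∣ T ∣ ≡ s → ∑ˢ (λ S → 𝟙 (T ⊆? S) * g (true ∷ S)) ≤ M
  h₁ T ∣T∣ = begin
    ∑ˢ (λ S → 𝟙 (T ⊆? S) * g (true ∷ S))    ≤⟨ m≤m+n _ _ ⟩
    -- The zero sum is the half of the sets that miss the first element: none of them contains
    -- `inside ∷ T`.
    ∑ˢ (λ S → 𝟙 (T ⊆? S) * g (true ∷ S)) + ∑ˢ {n} (λ S → 0) ≡⟨ sym (∑ˢ-suc (λ S → 𝟙 ((inside ∷ T) ⊆? S) * g S)) ⟩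
    ∑ˢ (λ S → 𝟙 ((inside ∷ T) ⊆? S) * g S)  ≤⟨ h (inside ∷ T) (cong suc ∣T∣) ⟩
    M                                       ∎
  h₀ : ∀ T → ∣ T ∣ ≡ suc s → ∑ˢ (λ S → 𝟙 (T ⊆? S) * g (false ∷ S)) ≤ M
  h₀ T ∣T∣ = begin
    ∑ˢ (λ S → 𝟙 (T ⊆? S) * g (false ∷ S))    ≤⟨ m≤n+m _ _ ⟩
    ∑ˢ (λ S → 𝟙 (T ⊆? S) * g (true ∷ S)) + ∑ˢ (λ S → 𝟙 (T ⊆? S) * g (false ∷ S)) ≡⟨ sym (∑ˢ-suc (λ S → 𝟙 ((outside ∷ T) ⊆? S) * g S)) ⟩
    ∑ˢ (λ S → 𝟙 ((outside ∷ T) ⊆? S) * g S)  ≤⟨ h (outside ∷ T) ∣T∣ ⟩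
    M                                        ∎

-- The factor `c` stands on the left because star bounds come as ratios with denominator `c`;
-- division is thereby avoided.
size-cover : {F G : Family n} (X : Subset n) (s c M : ℕ) → SubFamily G F →
  (∀ S → S ∈F G → s ≤ ∣ S ∩ X ∣) →
  (∀ T → ∣ T ∣ ≡ s → c * size (star F T) ≤ M) →
  c * size G ≤ (∣ X ∣ C s) * M
size-cover {n} {F} {G} X s c M G⊆F meets stars = begin
  c * size G                                    ≡⟨ cong (c *_) (size≡∑ G) ⟩
  c * ∑ˢ (λ S → 𝟙 (S ∈F? G))                    ≡⟨ sym (∑-*ˡ (allSubsets n) c _) ⟩
  ∑ˢ (λ S → c * 𝟙 (S ∈F? G))                    ≤⟨ ∑-mono (allSubsets n) pointwise ⟩
  ∑ˢ (λ S → 𝟙 (s ≤? ∣ S ∩ X ∣) * (c * 𝟙 (S ∈F? F)))   ≤⟨ cover (λ S → c * 𝟙 (S ∈F? F)) X s M stars′ ⟩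
  (∣ X ∣ C s) * M                               ∎
  where
  open ≤-Reasoning
  pointwise : ∀ S → c * 𝟙 (S ∈F? G) ≤ 𝟙 (s ≤? ∣ S ∩ X ∣) * (c * 𝟙 (S ∈F? F))
  pointwise S = *𝟙-≤ (S ∈F? G) c (λ S∈G → ≤𝟙* (s ≤? ∣ S ∩ X ∣) (meets S S∈G)
    (≤-trans (≤-reflexive (sym (*-identityʳ c))) (*-monoʳ-≤ c (1≤𝟙 (S ∈F? F) (G⊆F S S∈G)))))
  stars′ : ∀ T → ∣ T ∣ ≡ s → ∑ˢ (λ S → 𝟙 (T ⊆? S) * (c * 𝟙 (S ∈F? F))) ≤ M
  stars′ T ∣T∣ = begin
    ∑ˢ (λ S → 𝟙 (T ⊆? S) * (c * 𝟙 (S ∈F? F)))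
      ≤⟨ ∑-mono (allSubsets n) (λ S → 𝟙*-≤ (T ⊆? S) (λ T⊆S → *-monoʳ-≤ c
           (𝟙-≤ (S ∈F? F) (λ S∈F → 1≤𝟙 (S ∈F? star F T) (∈star⁺ {F = F} S∈F T⊆S))))) ⟩
    ∑ˢ (λ S → c * 𝟙 (S ∈F? star F T))    ≡⟨ ∑-*ˡ (allSubsets n) c _ ⟩
    c * ∑ˢ (λ S → 𝟙 (S ∈F? star F T))    ≡⟨ cong (c *_) (sym (size≡∑ (star F T))) ⟩
    c * size (star F T)                  ≤⟨ stars T ∣T∣ ⟩
    M                                    ∎

-- Comparing stars of consecutive codimension

-- Change of variables: inserting `y` is a bijection from the sets that avoid `y` to the sets that
-- contain it.
∑ˢ-insert : (y : Fin n) (φ : Subset n → ℕ) →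
  ∑ˢ (λ S → 𝟙 (y ∈? S) * φ S) ≡ ∑ˢ (λ S → 𝟙 (¬? (y ∈? S)) * φ (S ∪｛ y ｝))
∑ˢ-insert {suc n} zero φ = begin
  ∑ˢ (λ S → 𝟙 (zero ∈? S) * φ S)                       ≡⟨ ∑ˢ-suc (λ S → 𝟙 (zero ∈? S) * φ S) ⟩
  ∑ˢ (λ S → 1 * φ (true ∷ S)) + ∑ˢ {n} (λ S → 0)       ≡⟨ +-comm _ (∑ˢ {n} (λ S → 0)) ⟩
  ∑ˢ {n} (λ S → 0) + ∑ˢ (λ S → 1 * φ (true ∷ S))       ≡⟨ sym (∑ˢ-suc (λ S → 𝟙 (¬? (zero ∈? S)) * φ (S ∪｛ zero ｝))) ⟩
  ∑ˢ (λ S → 𝟙 (¬? (zero ∈? S)) * φ (S ∪｛ zero ｝))    ∎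
  where open ≡-Reasoning
∑ˢ-insert {suc n} (suc y) φ = begin
  ∑ˢ (λ S → 𝟙 (suc y ∈? S) * φ S)                         ≡⟨ ∑ˢ-suc (λ S → 𝟙 (suc y ∈? S) * φ S) ⟩
  ∑ˢ (λ S → 𝟙 (y ∈? S) * φ (true ∷ S)) + ∑ˢ (λ S → 𝟙 (y ∈? S) * φ (false ∷ S))
    ≡⟨ cong₂ _+_ (∑ˢ-insert y (φ ∘ (true ∷_))) (∑ˢ-insert y (φ ∘ (false ∷_))) ⟩
  ∑ˢ (λ S → 𝟙 (¬? (y ∈? S)) * φ (true ∷ (S ∪｛ y ｝))) + ∑ˢ (λ S → 𝟙 (¬? (y ∈? S)) * φ (false ∷ (S ∪｛ y ｝)))
    ≡⟨ sym (∑ˢ-suc (λ S → 𝟙 (¬? (suc y ∈? S)) * φ (S ∪｛ suc y ｝))) ⟩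
  ∑ˢ (λ S → 𝟙 (¬? (suc y ∈? S)) * φ (S ∪｛ suc y ｝))     ∎
  where open ≡-Reasoning

extend-to-base : (H : Family n) → Hereditary H → (S : Subset n) → S ∈F H →
  ∃ λ B → IsBase H B × S ⊆ B
extend-to-base {n} H her S = go S (⊃-wellFounded S)
  where
  go : ∀ S → Acc (λ P Q → Q ⊂ P) S → S ∈F H → ∃ λ B → IsBase H B × S ⊆ B
  go S (acc rec) S∈H with Fin.any? (λ x → ¬? (x ∈? S) ×-dec ((S ∪｛ x ｝) ∈F? H))
  ... | yes (x , x∉S , Sx∈H) with go (S ∪｛ x ｝) (rec (⊆-insert S x , x , []≔-updates S x , x∉S)) Sx∈H
  ...   | B , B-base , Sx⊆B = B , B-base , ⊆-trans (⊆-insert S x) Sx⊆B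
  -- By heredity, a member of `H` properly containing `S` would already allow one of its elements to
  -- be added to `S`.
  go S (acc rec) S∈H | no maximal = S , (S∈H , λ B B∈H S⊆B → ⊆-antisym S⊆B (λ {x} x∈B →
    decidable-stable (x ∈? S) (λ x∉S → maximal (x , x∉S , her B (S ∪｛ x ｝) (insert-⊆ S⊆B x∈B) B∈H)))) , id

module _ (H : Family n) (her : Hereditary H) (r c : ℕ) (μ≥c+r : μ≥ H (c + r)) where

  private F = upTo H r

  -- `S` lies in a base `B` with at least c + r elements. At least `c` of them are outside `S`, and
  -- adding any one of these gives a subset of `B`, hence a member of `H`.
  many-extensions : (S : Subset n) → S ∈F H → ∣ S ∣ ≤ r →
    c ≤ ∑ (allFin n) (λ y → 𝟙 (¬? (y ∈? S) ×-dec ((S ∪｛ y ｝) ∈F? H)))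
  many-extensions S S∈H ∣S∣≤r with extend-to-base H her S S∈H
  ... | B , B-base@(B∈H , _) , S⊆B = +-cancelˡ-≤ r _ _ (begin
    r + c                                             ≡⟨ +-comm r c ⟩
    c + r                                             ≤⟨ μ≥c+r B B-base ⟩
    ∣ B ∣                                             ≡⟨ sym (∑-card B) ⟩
    ∑ (allFin n) (λ y → 𝟙 (y ∈? B))                   ≤⟨ ∑-mono (allFin n) pointwise ⟩
    ∑ (allFin n) (λ y → 𝟙 (y ∈? S) + 𝟙 (new? y))      ≡⟨ ∑-+ (allFin n) _ _ ⟩
    ∑ (allFin n) (λ y → 𝟙 (y ∈? S)) + ∑ (allFin n) (λ y → 𝟙 (new? y))  ≡⟨ cong (_+ ∑ (allFin n) (λ y → 𝟙 (new? y))) (∑-card S) ⟩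
    ∣ S ∣ + ∑ (allFin n) (λ y → 𝟙 (new? y))           ≤⟨ +-monoˡ-≤ _ ∣S∣≤r ⟩
    r + ∑ (allFin n) (λ y → 𝟙 (new? y))               ∎)
    where
    open ≤-Reasoning
    new? : ∀ y → Dec (y ∉ S × (S ∪｛ y ｝) ∈F H)
    new? y = ¬? (y ∈? S) ×-dec ((S ∪｛ y ｝) ∈F? H)
    pointwise : ∀ y → 𝟙 (y ∈? B) ≤ 𝟙 (y ∈? S) + 𝟙 (new? y)
    pointwise y = 𝟙-≤ (y ∈? B) λ y∈B → case-split y∈B (y ∈? S)
      where
      case-split : y ∈ B → Dec (y ∈ S) → 1 ≤ 𝟙 (y ∈? S) + 𝟙 (new? y)
      case-split y∈B (yes y∈S) = m≤n⇒m≤n+o _ (1≤𝟙 (y ∈? S) y∈S)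
      case-split y∈B (no y∉S)  = m≤n⇒m≤o+n _ (1≤𝟙 (new? y) (y∉S , her B _ (insert-⊆ S⊆B y∈B) B∈H))

  private
    inS : Subset n → Subset n → ℕ
    inS T S = 𝟙 (S ∈F? star F T)

  -- Double counting of the pairs (S, y) with T ⊆ S, |S| < r, y ∉ S and S ∪ {y} ∈ H;
  -- removing x embeds the star of T ∪ {x} in the possible first coordinates.
  star-exchange : (T : Subset n) (x : Fin n) → x ∉ T →
    c * size (star F (T ∪｛ x ｝)) ≤ (r ∸ ∣ T ∣) * size (star F T)
  star-exchange T x x∉T = begin
    c * size (star F (T ∪｛ x ｝))                        ≡⟨ cong (c *_) (size≡∑ (star F (T ∪｛ x ｝))) ⟩
    c * ∑ˢ (inS (T ∪｛ x ｝))                             ≤⟨ *-monoʳ-≤ c (∑-mono (allSubsets n) contains-x) ⟩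
    c * ∑ˢ (λ S → 𝟙 (x ∈? S) * inS (T ∪｛ x ｝) S)        ≡⟨ cong (c *_) (∑ˢ-insert x (inS (T ∪｛ x ｝))) ⟩
    c * ∑ˢ (λ S → 𝟙 (¬? (x ∈? S)) * inS (T ∪｛ x ｝) (S ∪｛ x ｝))
                                                          ≤⟨ *-monoʳ-≤ c (∑-mono (allSubsets n) remove-x) ⟩
    c * ∑ˢ (λ S → 𝟙 (low? S))                             ≡⟨ sym (∑-*ˡ (allSubsets n) c _) ⟩
    ∑ˢ (λ S → c * 𝟙 (low? S))                             ≤⟨ ∑-mono (allSubsets n) add-y ⟩
    ∑ˢ (λ S → ∑ (allFin n) (λ y → 𝟙 (¬? (y ∈? T)) * (𝟙 (¬? (y ∈? S)) * inS T (S ∪｛ y ｝))))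
                                                          ≡⟨ ∑-swap (allSubsets n) (allFin n) _ ⟩
    ∑ (allFin n) (λ y → ∑ˢ (λ S → 𝟙 (¬? (y ∈? T)) * (𝟙 (¬? (y ∈? S)) * inS T (S ∪｛ y ｝))))
                                                          ≡⟨ ∑-cong (allFin n) reindex ⟩
    ∑ (allFin n) (λ y → ∑ˢ (λ S → 𝟙 (¬? (y ∈? T)) * (𝟙 (y ∈? S) * inS T S)))
                                                          ≡⟨ ∑-swap (allFin n) (allSubsets n) _ ⟩
    ∑ˢ (λ S → ∑ (allFin n) (λ y → 𝟙 (¬? (y ∈? T)) * (𝟙 (y ∈? S) * inS T S)))
                                                          ≤⟨ ∑-mono (allSubsets n) few-y ⟩
    ∑ˢ (λ S → (r ∸ ∣ T ∣) * inS T S)                      ≡⟨ ∑-*ˡ (allSubsets n) (r ∸ ∣ T ∣) _ ⟩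
    (r ∸ ∣ T ∣) * ∑ˢ (inS T)                              ≡⟨ cong ((r ∸ ∣ T ∣) *_) (sym (size≡∑ (star F T))) ⟩
    (r ∸ ∣ T ∣) * size (star F T)                         ∎
    where
    open ≤-Reasoning
    low? : ∀ S → Dec (T ⊆ S × S ∈F H × ∣ S ∣ < r)
    low? S = (T ⊆? S) ×-dec (S ∈F? H) ×-dec (∣ S ∣ <? r)

    contains-x : ∀ S → inS (T ∪｛ x ｝) S ≤ 𝟙 (x ∈? S) * inS (T ∪｛ x ｝) S
    contains-x S = 𝟙-≤ (S ∈F? star F (T ∪｛ x ｝)) (λ p →
      ≤𝟙* (x ∈? S) (proj₂ (∈star⁻ {F = F} {S = S} p) ([]≔-updates T x)) (1≤𝟙 (S ∈F? star F (T ∪｛ x ｝)) p))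

    remove-x : ∀ S → 𝟙 (¬? (x ∈? S)) * inS (T ∪｛ x ｝) (S ∪｛ x ｝) ≤ 𝟙 (low? S)
    remove-x S = 𝟙*-≤ (¬? (x ∈? S)) (λ x∉S → 𝟙-≤ ((S ∪｛ x ｝) ∈F? star F (T ∪｛ x ｝)) (λ p →
      let Sx∈F , Tx⊆Sx = ∈star⁻ {F = F} {S = S ∪｛ x ｝} p
          Sx∈H , ∣Sx∣≤r = ∈upTo⁻ {H = H} {S = S ∪｛ x ｝} Sx∈F
      in 1≤𝟙 (low? S) ( (λ y∈T → T⊆S x∉S Tx⊆Sx y∈T)
                      , her _ S (⊆-insert S x) Sx∈H
                      , ≤-trans (≤-reflexive (sym (∣insert∣ S x x∉S))) ∣Sx∣≤r)))
      where
      T⊆S : x ∉ S → T ∪｛ x ｝ ⊆ S ∪｛ x ｝ → T ⊆ S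
      T⊆S x∉S Tx⊆Sx y∈T with insert⁻ S x (Tx⊆Sx (⊆-insert T x y∈T))
      ... | inj₁ refl = contradiction y∈T x∉T
      ... | inj₂ y∈S  = y∈S

    add-y : ∀ S → c * 𝟙 (low? S) ≤ ∑ (allFin n) (λ y → 𝟙 (¬? (y ∈? T)) * (𝟙 (¬? (y ∈? S)) * inS T (S ∪｛ y ｝)))
    add-y S = *𝟙-≤ (low? S) c λ (T⊆S , S∈H , ∣S∣<r) → ≤-trans
      (many-extensions S S∈H (<⇒≤ ∣S∣<r))
      (∑-mono (allFin n) (λ y → 𝟙-≤ (¬? (y ∈? S) ×-dec ((S ∪｛ y ｝) ∈F? H)) (λ (y∉S , Sy∈H) →
        ≤𝟙* (¬? (y ∈? T)) (y∉S ∘ T⊆S) (≤𝟙* (¬? (y ∈? S)) y∉S (1≤𝟙 ((S ∪｛ y ｝) ∈F? star F T)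
          (∈star⁺ {F = F} (∈upTo⁺ {H = H} Sy∈H (≤-trans (≤-reflexive (∣insert∣ S y y∉S)) ∣S∣<r))
                  (⊆-trans T⊆S (⊆-insert S y))))))))

    reindex : ∀ y → ∑ˢ (λ S → 𝟙 (¬? (y ∈? T)) * (𝟙 (¬? (y ∈? S)) * inS T (S ∪｛ y ｝)))
                  ≡ ∑ˢ (λ S → 𝟙 (¬? (y ∈? T)) * (𝟙 (y ∈? S) * inS T S))
    reindex y = trans (∑-*ˡ (allSubsets n) (𝟙 (¬? (y ∈? T))) _)
      (trans (cong (𝟙 (¬? (y ∈? T)) *_) (sym (∑ˢ-insert y (inS T))))
             (sym (∑-*ˡ (allSubsets n) (𝟙 (¬? (y ∈? T))) _)))

    -- With S ∪ {y} as the new variable `S`, each member of the star of `T` is counted once for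
    -- every element it has outside `T`, and there are at most r - |T| of those.
    few-y : ∀ S → ∑ (allFin n) (λ y → 𝟙 (¬? (y ∈? T)) * (𝟙 (y ∈? S) * inS T S)) ≤ (r ∸ ∣ T ∣) * inS T S
    few-y S with S ∈F? star F T
    ... | no _  = ≤-trans (∑-mono (allFin n) (λ y → 𝟙*-≤ (¬? (y ∈? T)) {v = 0} (λ _ → 𝟙*-≤ (y ∈? S) (λ _ → z≤n))))
                    (≤-trans (≤-reflexive (∑-zero (allFin n))) z≤n)
    ... | yes p = ≤-trans (m+n≤o⇒m≤o∸n _ (begin
      ∑ (allFin n) (λ y → 𝟙 (¬? (y ∈? T)) * (𝟙 (y ∈? S) * 1)) + ∣ T ∣  ≡⟨ cong (∑ (allFin n) (λ y → 𝟙 (¬? (y ∈? T)) * (𝟙 (y ∈? S) * 1)) +_) (sym (∑-card T)) ⟩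
      _                                                               ≡⟨ sym (∑-+ (allFin n) _ _) ⟩
      ∑ (allFin n) (λ y → 𝟙 (¬? (y ∈? T)) * (𝟙 (y ∈? S) * 1) + 𝟙 (y ∈? T))  ≤⟨ ∑-mono (allFin n) pointwise ⟩
      ∑ (allFin n) (λ y → 𝟙 (y ∈? S))                                 ≡⟨ ∑-card S ⟩
      ∣ S ∣                                                           ≤⟨ proj₂ (∈upTo⁻ {H = H} {S = S} S∈F) ⟩
      r                                                               ∎))
      (≤-reflexive (sym (*-identityʳ (r ∸ ∣ T ∣))))
      where
      S∈F = proj₁ (∈star⁻ {F = F} {S = S} p)
      T⊆S = proj₂ (∈star⁻ {F = F} {T = T} {S = S} p)
      pointwise : ∀ y → 𝟙 (¬? (y ∈? T)) * (𝟙 (y ∈? S) * 1) + 𝟙 (y ∈? T) ≤ 𝟙 (y ∈? S)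
      pointwise y with y ∈? T
      ... | yes y∈T = 1≤𝟙 (y ∈? S) (T⊆S y∈T)
      ... | no _    = ≤-reflexive (trans (+-identityʳ _) (trans (+-identityʳ _) (*-identityʳ _)))

-- Sets that t-intersect all members of a family

⟦_⟧ : {P : Subset n → Set} → Decidable P → Family n
⟦ P? ⟧ S = does (P? S)

module _ {P : Subset n → Set} (P? : Decidable P) {S : Subset n} where

  ∈⟦⟧⁺ : P S → S ∈F ⟦ P? ⟧
  ∈⟦⟧⁺ = dec-true (P? S)

  ∈⟦⟧⁻ : S ∈F ⟦ P? ⟧ → P S
  ∈⟦⟧⁻ eq with P? S
  ... | yes p = p

module Core (t : ℕ) (U : Family n) where

  Central : Subset n → Set
  Central S = ∀ B → B ∈F U → t ≤ ∣ S ∩ B ∣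

  central? : Decidable Central
  central? S = map′ (λ none B B∈U → decidable-stable (t ≤? ∣ S ∩ B ∣) (λ t≰ → none (B , B∈U , t≰)))
                    (λ central (B , B∈U , t≰) → t≰ (central B B∈U))
                    (¬? (anySubset? (λ B → (B ∈F? U) ×-dec ¬? (t ≤? ∣ S ∩ B ∣))))

  inCore? : Decidable (λ S → S ∈F U × Central S)
  inCore? S = (S ∈F? U) ×-dec central? S

  inRest? : Decidable (λ S → S ∈F U × ¬ Central S)
  inRest? S = (S ∈F? U) ×-dec ¬? (central? S)

  core rest : Family n
  core = ⟦ inCore? ⟧
  rest = ⟦ inRest? ⟧

  core⊆U : SubFamily core U
  core⊆U S = proj₁ ∘ ∈⟦⟧⁻ inCore?

  rest⊆U : SubFamily rest U
  rest⊆U S = proj₁ ∘ ∈⟦⟧⁻ inRest?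

  core-central : ∀ {S B} → S ∈F core → B ∈F U → t ≤ ∣ S ∩ B ∣
  core-central S∈core = proj₂ (∈⟦⟧⁻ inCore? S∈core) _

  ∩-core : ∀ {S B} → S ∈F U → B ∈F core → t ≤ ∣ S ∩ B ∣
  ∩-core {S} {B} S∈U B∈core = subst (λ P → t ≤ ∣ P ∣) (∩-comm B S) (core-central B∈core S∈U)

-- If S ∩ Z has only t elements, it coincides with S ∩ A₁ and S ∩ A₂, hence with A₁ ∩ A₂.
∩⊆-if-tight : {t : ℕ} (A₁ A₂ : Subset n) {S Z : Subset n} → A₁ ⊆ Z → A₂ ⊆ Z →
  t ≤ ∣ S ∩ A₁ ∣ → t ≤ ∣ S ∩ A₂ ∣ → ∣ A₁ ∩ A₂ ∣ ≤ t → ∣ S ∩ Z ∣ ≤ t → A₁ ∩ A₂ ⊆ S ∩ Z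
∩⊆-if-tight {t = t} A₁ A₂ {S} {Z} A₁⊆Z A₂⊆Z t≤₁ t≤₂ ∣I∣≤t ∣SZ∣≤t =
  ⊆∧∣≥∣⇒⊇ (∩-⊆ {P = S ∩ Z} (Y⊆ A₁ A₁⊆Z t≤₁) (Y⊆ A₂ A₂⊆Z t≤₂))
           (≤-trans ∣I∣≤t (≤-trans t≤₁ (p⊆q⇒∣p∣≤∣q∣ (S∩⊆ A₁ A₁⊆Z))))
  where
  S∩⊆ : ∀ P → P ⊆ Z → S ∩ P ⊆ S ∩ Z
  S∩⊆ P P⊆Z = ∩-⊆ {P = S ∩ P} (p∩q⊆p S P) (P⊆Z ∘ p∩q⊆q S P)
  Y⊆ : ∀ P → P ⊆ Z → t ≤ ∣ S ∩ P ∣ → S ∩ Z ⊆ P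
  Y⊆ P P⊆Z t≤ x∈Y = p∩q⊆q S P (⊆∧∣≥∣⇒⊇ (S∩⊆ P P⊆Z) (≤-trans ∣SZ∣≤t t≤) x∈Y)

-- Lower bounds on `m`

2r≤m : ∀ r t → 2 * r ≤ m r t
2r≤m r t = m≤m⊔n (2 * r) _

r≤m : ∀ r t → r ≤ m r t
r≤m r t = ≤-trans (m≤m+n r _) (2r≤m r t)

-- With d = r - t, the hypothesis says x ≤ 3d + (t - 1). Moreover 6d ≤ d(d + 5), since d = 0 or d +
-- 5 ≥ 6, so halving reaches the second term of `m`.
3r∸2t∸1≤m : ∀ {r t x} → 1 ≤ t → t ≤ r → x + suc t + t ≤ r + r + r → x ≤ m r t
3r∸2t∸1≤m {t = suc t′} {x} 1≤t t≤r x≤ with m≤n⇒∃[o]m+o≡n t≤r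
... | d , refl rewrite m+n∸m≡n t′ d = ≤-trans x≤3d+t′
  (≤-trans (+-monoˡ-≤ t′ (≤-trans (≤-reflexive (sym (m*n/n≡m (3 * d) 2))) (/-monoˡ-≤ 2 (6d≤ d))))
           (m≤n⊔m (2 * (suc t′ + d)) _))
  where
  6d≤ : ∀ d → 3 * d * 2 ≤ d * (d + 5)
  6d≤ zero      = z≤n
  6d≤ d@(suc e) = ≤-trans (≤-reflexive (eq d)) (*-monoʳ-≤ d (+-monoˡ-≤ 5 (s≤s (z≤n {e}))))
    where
    eq : ∀ d → 3 * d * 2 ≡ d * 6
    eq = solve-∀
  x≤3d+t′ : x ≤ 3 * d + t′
  x≤3d+t′ = +-cancelʳ-≤ (suc (suc t′) + suc t′) x (3 * d + t′) (begin
    x + (suc (suc t′) + suc t′)                ≡⟨ sym (+-assoc x _ _) ⟩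
    x + suc (suc t′) + suc t′                  ≤⟨ x≤ ⟩
    suc (t′ + d) + suc (t′ + d) + suc (t′ + d) ≡⟨ eq t′ d ⟩
    3 * d + t′ + (suc (suc t′) + suc t′)       ∎)
    where
    open ≤-Reasoning
    eq : ∀ t d → suc (t + d) + suc (t + d) + suc (t + d) ≡ 3 * d + t + (suc (suc t) + suc t)
    eq = solve-∀

-- Structure of the core

module _ {t r : ℕ} (1≤t : 1 ≤ t) (t≤r : t ≤ r) (U : Family n) (bounded : ∀ S → S ∈F U → ∣ S ∣ ≤ r) where

  open Core t U

  -- In the last alternative both sets are kept for covering: `X` for the core, by stars of
  -- (t+1)-sets, and `S₀` for the rest, by stars of t-sets.
  core-structure :
      (∀ S → ¬ S ∈F core)
    ⊎ (∃ λ I → ∣ I ∣ ≡ t × (∀ S → S ∈F U → I ⊆ S))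
    ⊎ (∃₂ λ S₀ X → S₀ ∈F core × ∣ X ∣ ≤ m r t × (∀ S → S ∈F core → suc t ≤ ∣ S ∩ X ∣))
  core-structure with anySubset? (_∈F? core)
  ... | no empty = inj₁ (λ S S∈core → empty (S , S∈core))
  ... | yes (S₀ , S₀∈core)
    with anySubset? (λ A₁ → anySubset? (λ A₂ → (A₁ ∈F? core) ×-dec (A₂ ∈F? core) ×-dec (∣ A₁ ∩ A₂ ∣ ≤? t)))
  -- Any two core sets, equal ones included, meet in more than `t` points, so `S₀` itself serves as
  -- `X`.
  ...   | no none = inj₂ (inj₂ (S₀ , S₀ , S₀∈core , ≤-trans (bounded S₀ (core⊆U S₀ S₀∈core)) (r≤m r t) ,
            λ S S∈core → ≰⇒> (λ small → none (S , S₀ , S∈core , S₀∈core , small))))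
  ...   | yes (A₁ , A₂ , A₁∈core , A₂∈core , ∣I∣≤t)
    with anySubset? (λ B → (B ∈F? U) ×-dec ¬? ((A₁ ∩ A₂) ⊆? B))
  ...     | no none = inj₂ (inj₁ (A₁ ∩ A₂ , ≤-antisym ∣I∣≤t (core-central A₁∈core (core⊆U A₂ A₂∈core)) ,
              λ S S∈U → decidable-stable ((A₁ ∩ A₂) ⊆? S) (λ I⊈S → none (S , S∈U , I⊈S))))
  ...     | yes (B , B∈U , I⊈B) = inj₂ (inj₂ (S₀ , X , S₀∈core , 3r∸2t∸1≤m 1≤t t≤r ∣X∣≤ , meets))
    where
    A₁₂ X : Subset n
    A₁₂ = A₁ ∪ A₂
    X   = A₁₂ ∪ B
    -- An intersection of at most `t` points would contain A₁ ∩ A₂ and so force it into `B`. The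
    -- extra point gained here is the -1 in |X| ≤ 3r - 2t - 1.
    B∩A₁₂ : suc t ≤ ∣ B ∩ A₁₂ ∣
    B∩A₁₂ = ≰⇒> (λ small → I⊈B (p∩q⊆p B A₁₂ ∘
      ∩⊆-if-tight A₁ A₂ {B} {A₁₂} (p⊆p∪q A₂) (q⊆p∪q A₁ A₂) (∩-core B∈U A₁∈core) (∩-core B∈U A₂∈core) ∣I∣≤t small))
    -- If S ∩ X had at most `t` points, it would contain A₁ ∩ A₂ and coincide with its subset S ∩ B,
    -- again placing A₁ ∩ A₂ in `B`.
    meets : ∀ S → S ∈F core → suc t ≤ ∣ S ∩ X ∣
    meets S S∈core = ≰⇒> (λ small →
      let S∩B⊆S∩X = ∩-⊆ {P = S ∩ B} {S} {X} (p∩q⊆p S B) (q⊆p∪q A₁₂ B ∘ p∩q⊆q S B)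
          I⊆S∩X = ∩⊆-if-tight A₁ A₂ {S} {X} (p⊆p∪q B ∘ p⊆p∪q A₂) (p⊆p∪q B ∘ q⊆p∪q A₁ A₂)
                    (∩-core (core⊆U S S∈core) A₁∈core) (∩-core (core⊆U S S∈core) A₂∈core) ∣I∣≤t small
          S∩X⊆S∩B = ⊆∧∣≥∣⇒⊇ S∩B⊆S∩X (≤-trans small (core-central S∈core B∈U))
      in I⊈B (λ x∈I → p∩q⊆q S B (S∩X⊆S∩B (I⊆S∩X x∈I))))
    ∣X∣≤ : ∣ X ∣ + suc t + t ≤ r + r + r
    ∣X∣≤ = begin
      ∣ X ∣ + suc t + t                 ≤⟨ +-monoˡ-≤ t (+-monoʳ-≤ ∣ X ∣ (subst (λ P → suc t ≤ ∣ P ∣) (∩-comm B A₁₂) B∩A₁₂)) ⟩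
      ∣ X ∣ + ∣ A₁₂ ∩ B ∣ + t           ≡⟨ cong (_+ t) (∣∪∣+∣∩∣ A₁₂ B) ⟩
      ∣ A₁₂ ∣ + ∣ B ∣ + t               ≡⟨ swap-last ∣ A₁₂ ∣ ∣ B ∣ t ⟩
      ∣ A₁₂ ∣ + t + ∣ B ∣               ≤⟨ +-mono-≤ (+-monoʳ-≤ ∣ A₁₂ ∣ (core-central A₁∈core (core⊆U A₂ A₂∈core))) (bounded B B∈U) ⟩
      ∣ A₁₂ ∣ + ∣ A₁ ∩ A₂ ∣ + r         ≡⟨ cong (_+ r) (∣∪∣+∣∩∣ A₁ A₂) ⟩
      ∣ A₁ ∣ + ∣ A₂ ∣ + r               ≤⟨ +-monoˡ-≤ r (+-mono-≤ (bounded A₁ (core⊆U A₁ A₁∈core)) (bounded A₂ (core⊆U A₂ A₂∈core))) ⟩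
      r + r + r                         ∎
      where
      open ≤-Reasoning
      swap-last : ∀ a b c → a + b + c ≡ a + c + b
      swap-last = solve-∀

-- Multiplicities in a cross-t-intersecting system

module _ {t k : ℕ} (A : Fin k → Family n) (cross : CrossIntersecting t A) where

  union : Family n
  union = ⟦ (λ S → Fin.any? (λ i → S ∈F? A i)) ⟧

  ∈union⁻ : ∀ {S} → S ∈F union → ∃ λ i → S ∈F A i
  ∈union⁻ = ∈⟦⟧⁻ (λ S → Fin.any? (λ i → S ∈F? A i))

  open Core t union

  -- A set `B` from `A l` is compared with `S` as a member of whichever of `A i`, `A j` has an index
  -- different from `l`.
  central-of-two : ∀ {S i j} → i ≢ j → S ∈F A i → S ∈F A j → Central S
  central-of-two {S} {i} {j} i≢j S∈Aᵢ S∈Aⱼ B B∈U with ∈union⁻ B∈U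
  ... | l , B∈Aₗ with i Fin.≟ l
  ...   | no i≢l   = cross i l i≢l S B S∈Aᵢ B∈Aₗ
  ...   | yes refl = cross j i (i≢j ∘ sym) S B S∈Aⱼ B∈Aₗ

  -- A set outside the core lies in at most one `A i` by `central-of-two`; a core set is counted at
  -- most `k` times.
  multiplicity : ∀ S → ∑ (allFin k) (λ i → 𝟙 (S ∈F? A i)) ≤ k * 𝟙 (S ∈F? core) + 𝟙 (S ∈F? rest)
  multiplicity S = by-cases (Fin.any? (λ i → S ∈F? A i)) (central? S)
    where
    by-cases : Dec (∃ λ i → S ∈F A i) → Dec (Central S) →
      ∑ (allFin k) (λ i → 𝟙 (S ∈F? A i)) ≤ k * 𝟙 (S ∈F? core) + 𝟙 (S ∈F? rest)
    by-cases (no S∉U) _ = ≤-trans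
      (∑-mono (allFin k) (λ i → 𝟙-≤ (S ∈F? A i) {0} (λ S∈Aᵢ → ⊥-elim (S∉U (i , S∈Aᵢ)))))
      (≤-trans (≤-reflexive (∑-zero (allFin k))) z≤n)
    by-cases (yes S∈U) (yes central) = m≤n⇒m≤n+o _ (begin
      ∑ (allFin k) (λ i → 𝟙 (S ∈F? A i))   ≤⟨ ∑-allFin-≤ k (λ i → 𝟙-≤ (S ∈F? A i) (λ _ → ≤-refl)) ⟩
      k                                    ≡⟨ sym (*-identityʳ k) ⟩
      k * 1                                ≤⟨ *-monoʳ-≤ k (1≤𝟙 (S ∈F? core) (∈⟦⟧⁺ inCore? (∈⟦⟧⁺ (λ S → Fin.any? (λ i → S ∈F? A i)) S∈U , central))) ⟩
      k * 𝟙 (S ∈F? core)                   ∎)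
      where open ≤-Reasoning
    by-cases (yes S∈U) (no ¬central) = m≤n⇒m≤o+n (k * 𝟙 (S ∈F? core)) (≤-trans
      (∑-atMostOne k (λ i → S ∈F? A i) (λ i j S∈Aᵢ S∈Aⱼ →
        decidable-stable (i Fin.≟ j) (λ i≢j → ¬central (central-of-two i≢j S∈Aᵢ S∈Aⱼ))))
      (1≤𝟙 (S ∈F? rest) (∈⟦⟧⁺ inRest? (∈⟦⟧⁺ (λ S → Fin.any? (λ i → S ∈F? A i)) S∈U , ¬central))))

  sumSizes≤ : sumSizes A ≤ k * size core + size rest
  sumSizes≤ = begin
    ∑ (allFin k) (λ i → size (A i))                        ≡⟨ ∑-cong (allFin k) (λ i → size≡∑ (A i)) ⟩
    ∑ (allFin k) (λ i → ∑ˢ (λ S → 𝟙 (S ∈F? A i)))          ≡⟨ ∑-swap (allFin k) (allSubsets n) _ ⟩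
    ∑ˢ (λ S → ∑ (allFin k) (λ i → 𝟙 (S ∈F? A i)))          ≤⟨ ∑-mono (allSubsets n) multiplicity ⟩
    ∑ˢ (λ S → k * 𝟙 (S ∈F? core) + 𝟙 (S ∈F? rest))         ≡⟨ ∑-+ (allSubsets n) _ _ ⟩
    ∑ˢ (λ S → k * 𝟙 (S ∈F? core)) + ∑ˢ (λ S → 𝟙 (S ∈F? rest))
                                                           ≡⟨ cong₂ _+_ (∑-*ˡ (allSubsets n) k _) (sym (size≡∑ rest)) ⟩
    k * ∑ˢ (λ S → 𝟙 (S ∈F? core)) + size rest              ≡⟨ cong (λ s → k * s + size rest) (sym (size≡∑ core)) ⟩
    k * size core + size rest                              ∎
    where open ≤-Reasoning

-- Weighing the two parts

-- For positive `L` and `f` the last hypothesis reads a/L + b/f ≤ 1, so ka + b = (a/L)(kL) + (b/f)f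
-- is at most the larger of kL and f. The cases L = 0 and f = 0, where cancellation fails, are
-- treated apart.
weighted⇒max : ∀ k {f L a b} → a ≤ f → b ≤ f → f * a + L * b ≤ L * f → k * a + b ≤ (k * L) ⊔ f
weighted⇒max k {f} {zero} {a} {b} a≤f b≤f w = begin
  k * a + b         ≡⟨ cong (λ a → k * a + b) a≡0 ⟩
  k * 0 + b         ≡⟨ cong (_+ b) (*-zeroʳ k) ⟩
  b                 ≤⟨ b≤f ⟩
  f                 ≤⟨ m≤n⊔m (k * 0) f ⟩
  (k * 0) ⊔ f       ∎
  where
  open ≤-Reasoning
  square≤0⇒≡0 : ∀ a → a * a ≤ 0 → a ≡ 0
  square≤0⇒≡0 zero _ = refl
  -- For L = 0 the weighted inequality gives fa = 0, and a ≤ f then gives aa = 0.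
  a≡0 : a ≡ 0
  a≡0 = square≤0⇒≡0 a (≤-trans (*-monoˡ-≤ a a≤f) (≤-trans (m≤m+n (f * a) _) w))
weighted⇒max k {f} {L@(suc _)} {a} {b} a≤f b≤f w with ≤-total (k * L) f
... | inj₁ kL≤f = m≤n⇒m≤o⊔n (k * L) (*-cancelˡ-≤ L (begin
  L * (k * a + b)        ≡⟨ regroup L k a b ⟩
  k * L * a + L * b      ≤⟨ +-monoˡ-≤ (L * b) (*-monoˡ-≤ a kL≤f) ⟩
  f * a + L * b          ≤⟨ w ⟩
  L * f                  ∎))
  where
  open ≤-Reasoning
  regroup : ∀ L k a b → L * (k * a + b) ≡ k * L * a + L * b
  regroup = solve-∀
weighted⇒max k {zero} {suc _} {zero} {zero} a≤f b≤f w | inj₂ f≤kL =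
  ≤-trans (≤-reflexive (trans (+-identityʳ (k * 0)) (*-zeroʳ k))) z≤n
weighted⇒max k {f@(suc _)} {L@(suc _)} {a} {b} a≤f b≤f w | inj₂ f≤kL = m≤n⇒m≤n⊔o f (*-cancelˡ-≤ f (begin
  f * (k * a + b)              ≡⟨ regroup f k a b ⟩
  k * (f * a) + f * b          ≤⟨ +-monoʳ-≤ (k * (f * a)) (*-monoˡ-≤ b f≤kL) ⟩
  k * (f * a) + k * L * b      ≡⟨ regroup′ k (f * a) L b ⟩
  k * (f * a + L * b)          ≤⟨ *-monoʳ-≤ k w ⟩
  k * (L * f)                  ≡⟨ regroup″ k L f ⟩
  f * (k * L)                  ∎))
  where
  open ≤-Reasoning
  regroup : ∀ f k a b → f * (k * a + b) ≡ k * (f * a) + f * b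
  regroup = solve-∀
  regroup′ : ∀ k x L b → k * x + k * L * b ≡ k * (x + L * b)
  regroup′ = solve-∀
  regroup″ : ∀ k L f → k * (L * f) ≡ f * (k * L)
  regroup″ = solve-∀

-- Cross-multiplied form of a/L ≤ d/(d+1) and b/f ≤ 1/(d+1), two bounds whose sum is 1.
weighted-sum : ∀ d c {f L a b} → suc d * a ≤ d * L → suc d * b ≤ c * L → c * L ≤ f →
  f * a + L * b ≤ L * f
weighted-sum d c {f} {L} {a} {b} ha hb hf = *-cancelˡ-≤ (suc d) (begin
  suc d * (f * a + L * b)              ≡⟨ regroup (suc d) f a L b ⟩
  f * (suc d * a) + L * (suc d * b)    ≤⟨ +-mono-≤ (*-monoʳ-≤ f ha) (*-monoʳ-≤ L (≤-trans hb hf)) ⟩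
  f * (d * L) + L * f                  ≡⟨ regroup′ d f L ⟩
  suc d * (L * f)                      ∎)
  where
  open ≤-Reasoning
  regroup : ∀ e f a L b → e * (f * a + L * b) ≡ f * (e * a) + L * (e * b)
  regroup = solve-∀
  regroup′ : ∀ d f L → f * (d * L) + L * f ≡ suc d * (L * f)
  regroup′ = solve-∀

-- `*C≤C` yields C(2r - t + 1, t + 1), and t ≥ 1 bounds the upper index by 2r, the first term of
-- `m`.
binomial-ratio : ∀ {r t} → 1 ≤ t → t ≤ r → suc (r ∸ t) * (r C t) ≤ m r t C suc t
binomial-ratio {r} {t} 1≤t t≤r = ≤-trans (*C≤C (suc (r ∸ t)) r t) (C-mono (suc t) (≤-trans
  (+-monoˡ-≤ r (≤-trans (≤-reflexive (sym (+-∸-assoc 1 t≤r))) (∸-monoʳ-≤ (suc r) 1≤t)))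
  (≤-trans (≤-reflexive (cong (r +_) (sym (+-identityʳ r)))) (2r≤m r t))))

1≤C : ∀ {n k} → k ≤ n → 1 ≤ n C k
1≤C {n} {k} k≤n = ≤-trans (≤-reflexive (sym (nCn≡1 k))) (C-mono k k≤n)

-- Core and rest in a hereditary family with large bases

module _ {t r : ℕ} (1≤t : 1 ≤ t) (t≤r : t ≤ r)
         (H : Family n) (her : Hereditary H) (μ≥nS : μ≥ H (nS r t))
         (T : Subset n) (largest : IsLargestStar (upTo H r) t T) where

  private
    F = upTo H r
    L = size (star F T)
    c = m r t C suc t
    d = r ∸ t

  nS≡ : nS r t ≡ suc d * c + r
  nS≡ = cong (λ p → p + r) (cong₂ _*_ (+-comm d 1) (cong (m r t C_) (+-comm t 1)))

  exchange : ∀ S x → x ∉ S → (suc d * c) * size (star F (S ∪｛ x ｝)) ≤ (r ∸ ∣ S ∣) * size (star F S)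
  exchange = star-exchange H her r (suc d * c) (subst (μ≥ H) nS≡ μ≥nS)

  1≤c : 1 ≤ c
  1≤c = 1≤C (≤-trans (+-mono-≤ (≤-trans 1≤t t≤r) t≤r) (≤-trans (≤-reflexive (cong (r +_) (sym (+-identityʳ r)))) (2r≤m r t)))

  -- Removing one element leaves a t-set, whose star has at most `L` members.
  star-suc-t : ∀ S → ∣ S ∣ ≡ suc t → (suc d * c) * size (star F S) ≤ d * L
  star-suc-t S ∣S∣ with insert-view S ∣S∣
  ... | S₀ , x , x∉S₀ , refl , refl = ≤-trans (exchange S₀ x x∉S₀) (*-monoʳ-≤ d (proj₂ largest S₀ refl))

  -- The exchange is applied to `T` without one element. The remaining t - 1 elements give the
  -- factor r - t + 1 = `suc d`, which cancels.
  star-vs-all : c * L ≤ size F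
  star-vs-all with insert-view T (trans (proj₁ largest) (sym (m+[n∸m]≡n 1≤t)))
  ... | T₀ , x , x∉T₀ , ∣T₀∣ , T≡ = *-cancelˡ-≤ (suc d) (begin
    suc d * (c * L)                                 ≡⟨ sym (*-assoc (suc d) c L) ⟩
    (suc d * c) * L                                 ≡⟨ cong (λ S → (suc d * c) * size (star F S)) T≡ ⟩
    (suc d * c) * size (star F (T₀ ∪｛ x ｝))        ≤⟨ exchange T₀ x x∉T₀ ⟩
    (r ∸ ∣ T₀ ∣) * size (star F T₀)                 ≡⟨ cong (λ s → (r ∸ s) * size (star F T₀)) ∣T₀∣ ⟩
    (r ∸ (t ∸ 1)) * size (star F T₀)                ≤⟨ *-mono-≤ {r ∸ (t ∸ 1)} (m∸[n∸1]≤ r t) (size-mono {F = star F T₀} {F} (λ S → proj₁ ∘ ∈star⁻ {F = F} {T = T₀} {S})) ⟩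
    suc d * size F                                  ∎)
    where
    open ≤-Reasoning
    m∸[n∸1]≤ : ∀ r t → r ∸ (t ∸ 1) ≤ suc (r ∸ t)
    m∸[n∸1]≤ r       zero          = n≤1+n r
    m∸[n∸1]≤ r       (suc zero)    = m≤n+m∸n r 1
    m∸[n∸1]≤ zero    (suc (suc t)) = z≤n
    m∸[n∸1]≤ (suc r) (suc (suc t)) = m∸[n∸1]≤ r (suc t)

  module _ (U : Family n) (U⊆F : SubFamily U F) where

    open Core t U

    weighted : size F * size core + L * size rest ≤ L * size F
    weighted with core-structure 1≤t t≤r U (λ S S∈U → proj₂ (∈upTo⁻ {H = H} {S = S} (U⊆F S S∈U)))
    ... | inj₁ empty = begin
      size F * size core + L * size rest    ≡⟨ cong (λ a → size F * a + L * size rest) (size-empty core empty) ⟩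
      size F * 0 + L * size rest            ≡⟨ cong (_+ L * size rest) (*-zeroʳ (size F)) ⟩
      L * size rest                         ≤⟨ *-monoʳ-≤ L (size-mono {F = rest} {F} (λ S → U⊆F S ∘ rest⊆U S)) ⟩
      L * size F                            ∎
      where open ≤-Reasoning
    ... | inj₂ (inj₁ (I , ∣I∣ , I⊆)) = begin
      size F * size core + L * size rest    ≡⟨ cong (λ b → size F * size core + L * b) (size-empty rest no-rest) ⟩
      size F * size core + L * 0            ≡⟨ cong (size F * size core +_) (*-zeroʳ L) ⟩
      size F * size core + 0                ≡⟨ +-identityʳ _ ⟩
      size F * size core                    ≤⟨ *-monoʳ-≤ (size F) (≤-trans (size-mono {F = core} {star F I} core⊆star) (proj₂ largest I ∣I∣)) ⟩
      size F * L                            ≡⟨ *-comm (size F) L ⟩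
      L * size F                            ∎
      where
      open ≤-Reasoning
      core⊆star : SubFamily core (star F I)
      core⊆star S S∈core = ∈star⁺ {F = F} (U⊆F S (core⊆U S S∈core)) (I⊆ S (core⊆U S S∈core))
      no-rest : ∀ S → ¬ S ∈F rest
      no-rest S S∈rest with ∈⟦⟧⁻ inRest? {S} S∈rest
      -- Any two members of `U` share the t-set `I`, so every member is central.
      ... | S∈U , ¬central = ¬central (λ B B∈U →
        ≤-trans (≤-reflexive (sym ∣I∣)) (p⊆q⇒∣p∣≤∣q∣ (∩-⊆ {P = I} (I⊆ S S∈U) (I⊆ B B∈U))))
    ... | inj₂ (inj₂ (S₀ , X , S₀∈core , ∣X∣≤m , meets)) = weighted-sum d c core≤ rest≤ star-vs-all
      where
      open ≤-Reasoning
      instance c≢0 = >-nonZero 1≤c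
      core≤ : suc d * size core ≤ d * L
      -- The binomial `c` inside `nS` is there to absorb the number of stars covering the core.
      core≤ = *-cancelˡ-≤ c (begin
        c * (suc d * size core)       ≡⟨ regroup c d (size core) ⟩
        (suc d * c) * size core       ≤⟨ size-cover {F = F} X (suc t) (suc d * c) (d * L) (λ S → U⊆F S ∘ core⊆U S) meets star-suc-t ⟩
        (∣ X ∣ C suc t) * (d * L)     ≤⟨ *-monoˡ-≤ (d * L) (C-mono (suc t) ∣X∣≤m) ⟩
        c * (d * L)                   ∎)
        where
        regroup : ∀ c d a → c * (suc d * a) ≡ (suc d * c) * a
        regroup = solve-∀
      ∣S₀∣≤r : ∣ S₀ ∣ ≤ r
      ∣S₀∣≤r = proj₂ (∈upTo⁻ {H = H} {S = S₀} (U⊆F S₀ (core⊆U S₀ S₀∈core)))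
      rest≤ : suc d * size rest ≤ c * L
      rest≤ = begin
        suc d * size rest             ≡⟨ cong (suc d *_) (sym (*-identityˡ (size rest))) ⟩
        suc d * (1 * size rest)       ≤⟨ *-monoʳ-≤ (suc d) (size-cover {F = F} S₀ t 1 L (λ S → U⊆F S ∘ rest⊆U S)
                                           (λ S S∈rest → ∩-core (rest⊆U S S∈rest) S₀∈core)
                                           (λ S ∣S∣ → ≤-trans (≤-reflexive (*-identityˡ _)) (proj₂ largest S ∣S∣))) ⟩
        suc d * ((∣ S₀ ∣ C t) * L)    ≤⟨ *-monoʳ-≤ (suc d) (*-monoˡ-≤ L (C-mono t ∣S₀∣≤r)) ⟩
        suc d * ((r C t) * L)         ≡⟨ sym (*-assoc (suc d) (r C t) L) ⟩
        suc d * (r C t) * L           ≤⟨ *-monoˡ-≤ L (binomial-ratio 1≤t t≤r) ⟩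
        c * L                         ∎

theorem2p3 : (n t r k : ℕ) → 1 ≤ t → t ≤ r → 1 ≤ k →
    (H : Family n) → Hereditary H → μ≥ H (nS r t) →
    (A : Fin k → Family n) → ((i : Fin k) → SubFamily (A i) (upTo H r)) →
    CrossIntersecting t A →
    (T : Subset n) → IsLargestStar (upTo H r) t T →
    sumSizes A ≤ (k * size (star (upTo H r) T)) ⊔ size (upTo H r)
theorem2p3 n t r k 1≤t t≤r 1≤k H her μ≥nS A A⊆F cross T largest =
  ≤-trans (sumSizes≤ A cross) (weighted⇒max k
    (size-mono {F = core} {upTo H r} (λ S → U⊆F S ∘ core⊆U S))
    (size-mono {F = rest} {upTo H r} (λ S → U⊆F S ∘ rest⊆U S))
    (weighted 1≤t t≤r H her μ≥nS T largest (union A cross) U⊆F))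
  where
  open Core t (union A cross)
  U⊆F : SubFamily (union A cross) (upTo H r)
  U⊆F S S∈U with ∈union⁻ A cross S∈U
  ... | i , S∈Aᵢ = A⊆F i S S∈Aᵢ
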